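{- Let $f:2^V\to\mathbb{Z}$ be a submodular function on a ground set $V$ with $|V|=n$, accessible through an evaluation oracle taking time $\mathrm{EO}$ per query. A minimizer of $f$ can be found using $O(n^3\log n)$ evaluation oracle calls (i.e. total oracle time $O(n^3\log n\cdot\mathrm{EO})$); no bound on the additional computation time is claimed.
   Context: $f$ is submodular if $f(T\cup\{i\})-f(T)\le f(S\cup\{i\})-f(S)$ for all $S\subseteq T\subseteq V$ and $i\in V\setminus T$. -}

module Defs where

open import Data.Nat using (ℕ; zero; suc; _+_)
open import Data.Integer using (ℤ; _-_; _≤_)
open import Data.Fin using (Fin)
open import Data.Fin.Subset using (Subset; _⊆_; _∪_; ⁅_⁆; _∉_)

Submodular : {n : ℕ} → (Subset n → ℤ) → Set
Submodular {n} f = (S T : Subset n) (i : Fin n) → S ⊆ T → i ∉ T →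
  (f (T ∪ ⁅ i ⁆) - f T) ≤ (f (S ∪ ⁅ i ⁆) - f S)

IsMinimizer : {n : ℕ} → (Subset n → ℤ) → Subset n → Set
IsMinimizer {n} f S = (T : Subset n) → f S ≤ f T

-- A (deterministic, adaptive) evaluation-oracle algorithm on ground set Fin n:
-- a decision tree that either outputs a set, or queries the oracle on a set and
-- continues depending on the integer answer. Arbitrary computation between
-- queries is free (only oracle calls are counted).
data OracleAlg (n : ℕ) : Set where
  output : Subset n → OracleAlg n
  query  : Subset n → (ℤ → OracleAlg n) → OracleAlg n

run : {n : ℕ} → OracleAlg n → (Subset n → ℤ) → Subset n
run (output S)  f = S
run (query S k) f = run (k (f S)) f

calls : {n : ℕ} → OracleAlg n → (Subset n → ℤ) → ℕ
calls (output S)  f = 0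
calls (query S k) f = suc (calls (k (f S)) f)

{-# OPTIONS --safe #-}

-- A cutting-plane method over a finite set C of candidate minimizers. Querying f along a
-- maximal chain of sets gives Edmonds' greedy vector, a linear lower bound for f that is
-- exact on the chain, so every candidate whose bound is at least the best value seen can be
-- dropped. The order of the chain is obtained by sorting the coordinates of a centrepoint of
-- C (Helly's theorem, via Radon points): the linear bound at the centrepoint is an average of
-- values on the chain, so a fraction 1/(n+2) of C lies on the dropped side. Starting from
-- 2^n candidates, (n+1)^2 rounds of n+1 queries leave none, which even gives O(n^3) queries.
module Submission where

open import Defs
open import Data.Bool using (true; false; if_then_else_)
open import Data.Nat as ℕ using (ℕ; zero; suc)
open import Data.Nat.Logarithm using (⌊log₂_⌋; ⌊log₂⌋-mono-≤)
import Data.Nat.Properties as ℕ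
open import Data.Nat.Tactic.RingSolver using () renaming (solve-∀ to solveℕ-∀)
open import Data.Integer as ℤ using (ℤ; 0ℤ; 1ℤ; -1ℤ)
import Data.Integer.Properties as ℤ
open import Data.Integer.Tactic.RingSolver using (solve-∀)
open import Data.Fin using (Fin; zero; suc; punchIn; punchOut)
open import Data.Fin.Properties using (any?; punchIn-punchOut) renaming (_≟_ to _≟ᶠ_)
open import Data.Fin.Subset using (Subset; inside; outside; ⊥; ⊤; ⁅_⁆; _∪_; _∩_) renaming (_∈_ to _∈ˢ_; _∉_ to _∉ˢ_; _⊆_ to _⊆ˢ_)
open import Data.Fin.Subset.Properties using (_∈?_; x∈⁅x⁆; x∈⁅y⁆⇒x≡y; ⊥⊆; ⊆⊤; ⊆-antisym; p∩q⊆q; x∈p∩q⁺; x∈p∩q⁻; p⊆p∪q; q⊆p∪q; x∈p∪q⁻; ∩-distribˡ-∪; ∪-identityʳ; ∩-zeroʳ; ∩-identityʳ)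
open import Data.Vec using ([]; _∷_) renaming (lookup to lookupᵛ)
open import Data.Vec.Properties using ([]=⇒lookup; lookup⇒[]=)
open import Data.Vec.Functional using (insertAt)
open import Data.Vec.Functional.Properties using (insertAt-lookup; insertAt-punchIn)
open import Data.List using (List; []; _∷_; length; filter; map; _++_; zip; lookup; allFin)
open import Data.List.Properties using (length-++; length-map; length-tabulate)
open import Data.List.Extrema ℤ.≤-totalOrder using (argmin; argmin-all; f[argmin]≤f[⊤]; f[argmin]≤f[xs])
open import Data.List.Membership.Propositional using (_∈_)
open import Data.List.Membership.Propositional.Properties using (∈-++⁺ˡ; ∈-++⁺ʳ; ∈-++⁻; ∈-map⁺; ∈-map⁻; ∈-filter⁺; ∈-filter⁻; ∈-lookup; ∈-allFin)
open import Data.List.Relation.Unary.Any using (here; there; index)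
open import Data.List.Relation.Unary.Any.Properties using (lookup-index)
open import Data.List.Relation.Unary.All as All using (All; []; _∷_)
open import Data.List.Relation.Unary.All.Properties using (all-filter) renaming (map⁺ to All-map⁺; map⁻ to All-map⁻)
open import Data.List.Relation.Unary.AllPairs using (AllPairs; []; _∷_)
open import Data.List.Relation.Unary.Sorted.TotalOrder.Properties using (Sorted⇒AllPairs)
open import Data.List.Relation.Binary.Permutation.Propositional using (↭-sym)
open import Data.List.Relation.Binary.Permutation.Propositional.Properties using (↭-length; ∈-resp-↭)
open import Data.List.Relation.Binary.Sublist.Propositional as Sublist using (_⊆_; []; _∷_; _∷ʳ_; ⊆-refl; ⊆-trans)
open import Data.List.Relation.Binary.Sublist.Propositional.Properties using (filter-⊆)
import Data.List.Sort as Sort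
open import Data.Product using (Σ; ∃-syntax; _×_; _,_; proj₁; proj₂)
open import Data.Sum using (_⊎_; inj₁; inj₂)
open import Function using (_∘_)
open import Algebra.Properties.Semiring.Sum ℤ.+-*-semiring using (sum; sum-cong-≗; sum-remove; ∑-distrib-+; *-distribˡ-sum; *-distribʳ-sum; sum-replicate-zero)
open import Relation.Binary.Bundles using (DecTotalOrder)
import Relation.Binary.Construct.Flip.EqAndOrd as Flip
import Relation.Binary.Construct.On as On
open import Relation.Nullary using (¬_; yes; no; contradiction; ¬?)
open import Relation.Nullary.Decidable using (decidable-stable)
open import Relation.Binary.PropositionalEquality using (_≡_; _≢_; refl; sym; trans; cong; cong₂; subst; subst₂; module ≡-Reasoning)

private variable
  m n : ℕ
  A : Set

-- Linear dependence of integer vectors.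

module LinearAlgebra where
  open import Data.Integer using (_+_; _*_; -_; _-_; _≤_; _<_; +_; -[1+_]; +≤+; +<+)

  sum-zero : {t : Fin m → ℤ} → (∀ j → t j ≡ 0ℤ) → sum t ≡ 0ℤ
  sum-zero {m} t≡0 = trans (sum-cong-≗ t≡0) (sum-replicate-zero m)

  -- Gaussian elimination without division, one coordinate at a time: a vector `v j₀` whose first
  -- coordinate `c` is nonzero clears that coordinate from all the others, once these are multiplied
  -- by `c`.
  linear-dependence : ∀ d → d ℕ.< m → (v : Fin m → Fin d → ℤ) →
    Σ (Fin m → ℤ) λ a → (∃[ j ] a j ≢ 0ℤ) × (∀ k → sum (λ j → a j * v j k) ≡ 0ℤ)
  linear-dependence {suc m} zero _ v = (λ _ → 1ℤ) , (zero , λ ()) , λ ()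
  linear-dependence {suc m} (suc d) d<m v with any? (λ j → ¬? (v j zero ℤ.≟ 0ℤ))
  ... | no allZero =
    let a , a≢0 , relation = linear-dependence d (ℕ.<-trans (ℕ.n<1+n d) d<m) (λ j k → v j (suc k))
        firstZero j = decidable-stable (v j zero ℤ.≟ 0ℤ) (λ ≢0 → allZero (j , ≢0))
    in a , a≢0 , λ where
      zero    → sum-zero (λ j → trans (cong (a j *_) (firstZero j)) (ℤ.*-zeroʳ (a j)))
      (suc k) → relation k
  ... | yes (j₀ , c≢0) =
    let b , (i , bi≢0) , relation = linear-dependence d (ℕ.s<s⁻¹ d<m) (λ i k → w i (suc k))
    in a b , (punchIn j₀ i , a≢0 b i bi≢0) , λ where
      zero    → trans (eliminate b zero) (sum-zero (λ i → cancel (b i) c (u i zero)))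
      (suc k) → trans (eliminate b (suc k)) (relation k)
    where
    open ≡-Reasoning
    c = v j₀ zero
    u : Fin m → Fin (suc d) → ℤ
    u i = v (punchIn j₀ i)
    w : Fin m → Fin (suc d) → ℤ
    w i k = c * u i k - u i zero * v j₀ k
    s : (Fin m → ℤ) → ℤ
    s b = sum (λ i → b i * u i zero)
    -- Expanding a relation `b` among the `w i` in terms of `v` gives `c * b i` at the other vectors
    -- and collects `- s b` at `v j₀`. It stays nontrivial because the integers have no zero
    -- divisors.
    a : (Fin m → ℤ) → Fin (suc m) → ℤ
    a b = insertAt (λ i → c * b i) j₀ (- s b)
    cancel : ∀ b c x → b * (c * x - x * c) ≡ 0ℤ
    cancel = solve-∀
    a≢0 : ∀ b i → b i ≢ 0ℤ → a b (punchIn j₀ i) ≢ 0ℤ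
    a≢0 b i bi≢0 a≡0
      with ℤ.i*j≡0⇒i≡0∨j≡0 c (trans (sym (insertAt-punchIn (λ i → c * b i) j₀ (- s b) i)) a≡0)
    ... | inj₁ c≡0 = c≢0 c≡0
    ... | inj₂ b≡0 = bi≢0 b≡0
    eliminate : ∀ b k → sum (λ j → a b j * v j k) ≡ sum (λ i → b i * w i k)
    eliminate b k = begin
      sum (λ j → a b j * v j k)
        ≡⟨ sum-remove {i = j₀} (λ j → a b j * v j k) ⟩
      a b j₀ * v j₀ k + sum (λ i → a b (punchIn j₀ i) * u i k)
        ≡⟨ cong₂ _+_ (cong (_* v j₀ k) (insertAt-lookup (λ i → c * b i) j₀ (- s b)))
             (sum-cong-≗ (λ i → cong (_* u i k) (insertAt-punchIn (λ i → c * b i) j₀ (- s b) i))) ⟩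
      - s b * v j₀ k + sum (λ i → c * b i * u i k)
        ≡⟨ cong (_+ sum (λ i → c * b i * u i k)) (rearrange₁ (s b) (v j₀ k)) ⟩
      s b * - v j₀ k + sum (λ i → c * b i * u i k)
        ≡⟨ cong (_+ sum (λ i → c * b i * u i k)) (*-distribʳ-sum (- v j₀ k) (λ i → b i * u i zero)) ⟩
      sum (λ i → b i * u i zero * - v j₀ k) + sum (λ i → c * b i * u i k)
        ≡⟨ ∑-distrib-+ (λ i → b i * u i zero * - v j₀ k) (λ i → c * b i * u i k) ⟨
      sum (λ i → b i * u i zero * - v j₀ k + c * b i * u i k)
        ≡⟨ sum-cong-≗ (λ i → rearrange₂ (b i) (u i zero) (v j₀ k) c (u i k)) ⟩
      sum (λ i → b i * w i k) ∎
      where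
      rearrange₁ : ∀ x y → - x * y ≡ x * - y
      rearrange₁ = solve-∀
      rearrange₂ : ∀ p q r c x → p * q * - r + c * p * x ≡ p * (c * x - q * r)
      rearrange₂ = solve-∀

  sum-nonneg : {t : Fin m → ℤ} → (∀ j → 0ℤ ≤ t j) → 0ℤ ≤ sum t
  sum-nonneg {zero}  _   = ℤ.≤-refl
  sum-nonneg {suc m} 0≤t = ℤ.+-mono-≤ (0≤t zero) (sum-nonneg (0≤t ∘ suc))

  sum-pos : {t : Fin m → ℤ} → (∀ j → 0ℤ ≤ t j) → ∀ j → 0ℤ < t j → 0ℤ < sum t
  sum-pos 0≤t zero    0<t = ℤ.+-mono-<-≤ 0<t (sum-nonneg (0≤t ∘ suc))
  sum-pos 0≤t (suc j) 0<t = ℤ.+-mono-≤-< (0≤t zero) (sum-pos (0≤t ∘ suc) j 0<t)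

  *-nonneg : ∀ {i j} → 0ℤ ≤ i → 0ℤ ≤ j → 0ℤ ≤ i * j
  *-nonneg {i} {j} 0≤i 0≤j =
    subst (_≤ i * j) (ℤ.*-zeroʳ i) (ℤ.*-monoˡ-≤-nonNeg i {{ℤ.nonNegative 0≤i}} 0≤j)

  *-pos : ∀ {i j} → 0ℤ < i → 0ℤ < j → 0ℤ < i * j
  *-pos {i} {j} 0<i 0<j =
    subst (_< i * j) (ℤ.*-zeroʳ i) (ℤ.*-monoˡ-<-pos i {{ℤ.positive 0<i}} 0<j)

  -- Positive and negative parts of coefficients.

  positivePart negativePart : ℤ → ℤ
  positivePart (+ n)    = + n
  positivePart -[1+ n ] = 0ℤ
  negativePart (+ n)    = 0ℤ
  negativePart -[1+ n ] = + suc n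

  parts-difference : ∀ a → a ≡ positivePart a - negativePart a
  parts-difference (+ n)    = sym (ℤ.+-identityʳ (+ n))
  parts-difference -[1+ n ] = refl

  positivePart-nonneg : ∀ a → 0ℤ ≤ positivePart a
  positivePart-nonneg (+ n)    = +≤+ ℕ.z≤n
  positivePart-nonneg -[1+ n ] = ℤ.≤-refl

  negativePart-nonneg : ∀ a → 0ℤ ≤ negativePart a
  negativePart-nonneg (+ n)    = ℤ.≤-refl
  negativePart-nonneg -[1+ n ] = +≤+ ℕ.z≤n

  part-zero : ∀ a → positivePart a ≡ 0ℤ ⊎ negativePart a ≡ 0ℤ
  part-zero (+ n)    = inj₂ refl
  part-zero -[1+ n ] = inj₁ refl

  part-pos : ∀ a → a ≢ 0ℤ → 0ℤ < positivePart a ⊎ 0ℤ < negativePart a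
  part-pos (+ zero)  a≢0 = contradiction refl a≢0
  part-pos (+ suc n) _   = inj₁ (+<+ ℕ.z<s)
  part-pos -[1+ n ]  _   = inj₂ (+<+ ℕ.z<s)

  -- Moving the negative terms to the other side turns a linear relation into the two
  -- representations of a Radon point.
  sum-parts : (a p : Fin m → ℤ) → sum (λ j → a j * p j) ≡ 0ℤ →
    sum (λ j → positivePart (a j) * p j) ≡ sum (λ j → negativePart (a j) * p j)
  sum-parts a p relation = begin
    sum (λ j → positivePart (a j) * p j)
      ≡⟨ sum-cong-≗ (λ j → trans (regroup (positivePart (a j)) (negativePart (a j)) (p j))
           (cong (λ x → x * p j + negativePart (a j) * p j) (sym (parts-difference (a j))))) ⟩
    sum (λ j → a j * p j + negativePart (a j) * p j)
      ≡⟨ ∑-distrib-+ (λ j → a j * p j) (λ j → negativePart (a j) * p j) ⟩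
    sum (λ j → a j * p j) + sum (λ j → negativePart (a j) * p j)
      ≡⟨ cong (_+ sum (λ j → negativePart (a j) * p j)) relation ⟩
    0ℤ + sum (λ j → negativePart (a j) * p j)
      ≡⟨ ℤ.+-identityˡ _ ⟩
    sum (λ j → negativePart (a j) * p j) ∎
    where
    open ≡-Reasoning
    regroup : ∀ x y z → x * z ≡ (x - y) * z + y * z
    regroup = solve-∀

  -- Linear functionals and Helly's theorem for cones.

  private variable d : ℕ

  -- Sparse, so that functionals with few terms can be written out directly and the greedy
  -- functional grows by one term per element of the chain.
  Functional : ℕ → Set
  Functional d = List (Fin d × ℤ)

  apply : Functional d → (Fin d → ℤ) → ℤ
  apply []            z = 0ℤ
  apply ((k , c) ∷ φ) z = c * z k + apply φ z

  combination : (Fin m → ℤ) → (Fin m → Fin d → ℤ) → Fin d → ℤ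
  combination c p k = sum (λ j → c j * p j k)

  apply-cong : ∀ (φ : Functional d) {y z} → (∀ k → y k ≡ z k) → apply φ y ≡ apply φ z
  apply-cong []            y≗z = refl
  apply-cong ((k , c) ∷ φ) y≗z = cong₂ _+_ (cong (c *_) (y≗z k)) (apply-cong φ y≗z)

  apply-combination : ∀ (φ : Functional d) (c : Fin m → ℤ) p →
    apply φ (combination c p) ≡ sum (λ j → c j * apply φ (p j))
  apply-combination []            c p = sym (sum-zero (λ j → ℤ.*-zeroʳ (c j)))
  apply-combination ((k , e) ∷ φ) c p = begin
    e * sum (λ j → c j * p j k) + apply φ (combination c p)
      ≡⟨ cong₂ _+_ (*-distribˡ-sum e (λ j → c j * p j k)) (apply-combination φ c p) ⟩
    sum (λ j → e * (c j * p j k)) + sum (λ j → c j * apply φ (p j))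
      ≡⟨ ∑-distrib-+ (λ j → e * (c j * p j k)) (λ j → c j * apply φ (p j)) ⟨
    sum (λ j → e * (c j * p j k) + c j * apply φ (p j))
      ≡⟨ sum-cong-≗ (λ j → regroup e (c j) (p j k) (apply φ (p j))) ⟩
    sum (λ j → c j * (e * p j k + apply φ (p j))) ∎
    where
    open ≡-Reasoning
    regroup : ∀ e c x y → e * (c * x) + c * y ≡ c * (e * x + y)
    regroup = solve-∀

  -- The i-th closed convex cone is the set of points on which all of Dual i is nonnegative.
  module Helly {n : ℕ} {I : Set} (Dual : I → Functional (suc n) → Set) where

    -- With positive height `z zero`, an integer vector stands for the rational point with
    -- coordinates `z k / z zero`; no fractions are needed.
    CommonPoint : (Fin m → I) → Set
    CommonPoint F = Σ (Fin (suc n) → ℤ) λ z → 0ℤ < z zero × (∀ i φ → Dual (F i) φ → 0ℤ ≤ apply φ z)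

    -- Induction on the size of the family. If it exceeds the dimension `suc n`, the points `p j`
    -- common to all cones but the `j`-th are linearly dependent, and their Radon point lies in
    -- every cone.
    helly : (∀ {m} → m ℕ.≤ suc n → (F : Fin m → I) → CommonPoint F) →
      ∀ m (F : Fin m → I) → CommonPoint F
    helly small zero    F = small ℕ.z≤n F
    helly small (suc m) F with suc m ℕ.≤? suc n
    ... | yes m≤n = small m≤n F
    ... | no  m≰n =
      let a , (j , aj≢0) , relation = linear-dependence (suc n) (ℕ.≰⇒> m≰n) p
      in z a , z-pos a relation j (part-pos (a j) aj≢0) , z-dual a relation
      where
      q : ∀ j → CommonPoint (F ∘ punchIn j)
      q j = helly small m (F ∘ punchIn j)
      p : Fin (suc m) → Fin (suc n) → ℤ
      p j = proj₁ (q j)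
      p-dual : ∀ {i j} → j ≢ i → ∀ φ → Dual (F i) φ → 0ℤ ≤ apply φ (p j)
      p-dual {i} {j} j≢i φ dual = proj₂ (proj₂ (q j)) (punchOut j≢i) φ
        (subst (λ k → Dual (F k) φ) (sym (punchIn-punchOut j≢i)) dual)
      -- The Radon point: for each i one of its two representations, by the positive and
      -- by the negative coefficients, avoids p i, the only point that may miss F i.
      z : (Fin (suc m) → ℤ) → Fin (suc n) → ℤ
      z a = combination (positivePart ∘ a) p

      Relation : (Fin (suc m) → ℤ) → Set
      Relation a = ∀ k → sum (λ j → a j * p j k) ≡ 0ℤ

      z-negative : ∀ a → Relation a → ∀ k → z a k ≡ combination (negativePart ∘ a) p k
      z-negative a relation k = sum-parts a (λ j → p j k) (relation k)

      combination-pos : ∀ c → (∀ j → 0ℤ ≤ c j) → ∀ j → 0ℤ < c j → 0ℤ < combination c p zero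
      combination-pos c 0≤c j 0<c = sum-pos
        (λ j → *-nonneg (0≤c j) (ℤ.<⇒≤ (proj₁ (proj₂ (q j))))) j
        (*-pos 0<c (proj₁ (proj₂ (q j))))

      -- All `p j` have positive height, so one positive coefficient in either representation
      -- suffices.
      z-pos : ∀ a → Relation a → ∀ j → 0ℤ < positivePart (a j) ⊎ 0ℤ < negativePart (a j) →
        0ℤ < z a zero
      z-pos a relation j (inj₁ 0<) =
        combination-pos (positivePart ∘ a) (positivePart-nonneg ∘ a) j 0<
      z-pos a relation j (inj₂ 0<) = subst (0ℤ <_) (sym (z-negative a relation zero))
        (combination-pos (negativePart ∘ a) (negativePart-nonneg ∘ a) j 0<)

      combination-dual : ∀ c → (∀ j → 0ℤ ≤ c j) → ∀ i → c i ≡ 0ℤ →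
        ∀ φ → Dual (F i) φ → 0ℤ ≤ apply φ (combination c p)
      combination-dual c 0≤c i ci≡0 φ dual =
        subst (0ℤ ≤_) (sym (apply-combination φ c p)) (sum-nonneg term)
        where
        term : ∀ j → 0ℤ ≤ c j * apply φ (p j)
        term j with j ≟ᶠ i
        ... | yes refl = ℤ.≤-reflexive
          (sym (trans (cong (_* apply φ (p j)) ci≡0) (ℤ.*-zeroˡ (apply φ (p j)))))
        ... | no j≢i   = *-nonneg (0≤c j) (p-dual j≢i φ dual)

      z-dual : ∀ a → Relation a → ∀ i φ → Dual (F i) φ → 0ℤ ≤ apply φ (z a)
      z-dual a relation i φ dual with part-zero (a i)
      ... | inj₁ pos≡0 =
        combination-dual (positivePart ∘ a) (positivePart-nonneg ∘ a) i pos≡0 φ dual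
      ... | inj₂ neg≡0 = subst (0ℤ ≤_) (sym (apply-cong φ (z-negative a relation)))
        (combination-dual (negativePart ∘ a) (negativePart-nonneg ∘ a) i neg≡0 φ dual)

open LinearAlgebra

-- Intersections of large sublists.

module Sublists where
  open import Data.Nat using (_+_; _*_; _≤_; _<_; s≤s; z≤n)

  sublists : List A → List (List A)
  sublists []       = [] ∷ []
  sublists (x ∷ xs) = sublists xs ++ map (x ∷_) (sublists xs)

  ∈-sublists⁺ : {B C : List A} → B ⊆ C → B ∈ sublists C
  ∈-sublists⁺ []       = here refl
  ∈-sublists⁺ (y ∷ʳ p) = ∈-++⁺ˡ (∈-sublists⁺ p)
  ∈-sublists⁺ {C = x ∷ C} (refl ∷ p) =
    ∈-++⁺ʳ (sublists C) (∈-map⁺ (x ∷_) (∈-sublists⁺ p))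

  ∈-sublists⁻ : {B : List A} (C : List A) → B ∈ sublists C → B ⊆ C
  ∈-sublists⁻ []      (here refl) = []
  ∈-sublists⁻ (x ∷ C) B∈ with ∈-++⁻ (sublists C) B∈
  ... | inj₁ B∈C = x ∷ʳ ∈-sublists⁻ C B∈C
  ... | inj₂ B∈map with ∈-map⁻ (x ∷_) B∈map
  ...   | _ , B∈C , refl = refl ∷ ∈-sublists⁻ C B∈C

  both-suc : ∀ a c {b d} → a + b ≤ c + d → a + suc b ≤ c + suc d
  both-suc a c {b} {d} le = subst₂ _≤_ (sym (ℕ.+-suc a b)) (sym (ℕ.+-suc c d)) (s≤s le)

  -- Inclusion-exclusion inside `C`: `E` keeps the positions selected by both embeddings. Working
  -- with positions rather than values makes this correct for lists with repetitions.
  ⊆-intersection : {D B C : List A} → D ⊆ C → B ⊆ C →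
    ∃[ E ] E ⊆ D × E ⊆ B × length D + length B ≤ length E + length C
  ⊆-intersection [] [] = [] , [] , [] , z≤n
  ⊆-intersection {C = y ∷ C} (y ∷ʳ p) (.y ∷ʳ q) =
    let E , E⊆D , E⊆B , le = ⊆-intersection p q
    in E , E⊆D , E⊆B , ℕ.≤-trans le (ℕ.+-monoʳ-≤ (length E) (ℕ.n≤1+n (length C)))
  ⊆-intersection {D = D} {C = y ∷ C} (y ∷ʳ p) (refl ∷ q) =
    let E , E⊆D , E⊆B , le = ⊆-intersection p q
    in E , E⊆D , y ∷ʳ E⊆B , both-suc (length D) (length E) le
  ⊆-intersection {C = y ∷ C} (refl ∷ p) (y ∷ʳ q) =
    let E , E⊆D , E⊆B , le = ⊆-intersection p q
    in E , y ∷ʳ E⊆D , E⊆B , ℕ.≤-trans (s≤s le) (ℕ.≤-reflexive (sym (ℕ.+-suc (length E) (length C))))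
  ⊆-intersection {D = _ ∷ D} {C = y ∷ C} (refl ∷ p) (refl ∷ q) =
    let E , E⊆D , E⊆B , le = ⊆-intersection p q
    in y ∷ E , refl ∷ E⊆D , refl ∷ E⊆B , s≤s (both-suc (length D) (length E) le)

  -- `B` omits less than a fraction 1/(d+1) of `C`, stated without division.
  Large : ℕ → List A → List A → Set
  Large d C B = B ⊆ C × d * length C < suc d * length B

  -- Union bound on the omitted parts: `m` sublists together omit at most m/(d+1) of `C`.
  large-intersection : ∀ d {C : List A} (F : Fin m → List A) → (∀ i → Large d C (F i)) →
    ∃[ E ] E ⊆ C × (∀ i → E ⊆ F i) × suc d * length C ≤ suc d * length E + m * length C
  large-intersection {m = zero} d {C} F large = C , ⊆-refl , (λ ()) , ℕ.m≤m+n _ _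
  large-intersection {m = suc m} d {C} F large =
    let D , D⊆C , D⊆F , leD = large-intersection d (F ∘ suc) (large ∘ suc)
        E , E⊆D , E⊆B , leE = ⊆-intersection D⊆C (proj₁ (large zero))
    in E , ⊆-trans E⊆D D⊆C , (λ { zero → E⊆B ; (suc i) → ⊆-trans E⊆D (D⊆F i) }) ,
       count (length D) (length (F zero)) (length E) (length C) leD leE (ℕ.<⇒≤ (proj₂ (large zero)))
    where
    open ℕ.≤-Reasoning
    regroup₁ : ∀ d x y N m → (suc d * x + m * N) + suc d * y + N ≡ suc d * (x + y) + suc m * N
    regroup₁ = solveℕ-∀
    regroup₂ : ∀ d e N m → suc d * (e + N) + suc m * N ≡ suc d * e + suc m * N + suc d * N
    regroup₂ = solveℕ-∀
    regroup₃ : ∀ d N → suc d * N + suc d * N ≡ suc d * N + d * N + N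
    regroup₃ = solveℕ-∀
    -- To avoid subtraction, `suc d * N` is added on both sides and cancelled at the end.
    count : ∀ x y e N → suc d * N ≤ suc d * x + m * N → x + y ≤ e + N → d * N ≤ suc d * y →
      suc d * N ≤ suc d * e + suc m * N
    count x y e N p q r = ℕ.+-cancelʳ-≤ (suc d * N) (suc d * N) (suc d * e + suc m * N) (begin
      suc d * N + suc d * N                 ≡⟨ regroup₃ d N ⟩
      suc d * N + d * N + N                 ≤⟨ ℕ.+-monoˡ-≤ N (ℕ.+-mono-≤ p r) ⟩
      suc d * x + m * N + suc d * y + N     ≡⟨ regroup₁ d x y N m ⟩
      suc d * (x + y) + suc m * N           ≤⟨ ℕ.+-monoˡ-≤ (suc m * N) (ℕ.*-monoʳ-≤ (suc d) q) ⟩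
      suc d * (e + N) + suc m * N           ≡⟨ regroup₂ d e N m ⟩
      suc d * e + suc m * N + suc d * N     ∎)

  large-common : ∀ {d} {C : List A} → 0 < length C → m ≤ d → (F : Fin m → List A) →
    (∀ i → Large d C (F i)) → ∃[ x ] (∀ i → x ∈ F i)
  large-common {m = m} {d} {C} 0<N m≤d F large with large-intersection d F large
  ... | x ∷ E , _ , E⊆F , _ = x , λ i → Sublist.lookup (E⊆F i) (here refl)
  -- An empty intersection would mean (d+1)N ≤ mN ≤ dN for the positive length N of `C`.
  ... | [] , _ , _ , le = contradiction
    (ℕ.<-≤-trans (ℕ.+-monoˡ-< (d * length C) 0<N) (ℕ.≤-trans le
      (ℕ.≤-trans (ℕ.≤-reflexive (cong (_+ m * length C) (ℕ.*-zeroʳ d)))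
        (ℕ.*-monoˡ-≤ (length C) m≤d))))
    (ℕ.<-irrefl refl)

open Sublists

-- Centrepoints of finite point sets.

module Centrepoint {n : ℕ} {A : Set}
  (pt : A → Fin (suc n) → ℤ) (pt-height : ∀ x → pt x zero ≡ 1ℤ) where
  open import Data.Integer using (_+_; -_; _≤_; _<_; +<+)

  NonnegOn : List A → Functional (suc n) → Set
  NonnegOn B φ = All (λ x → 0ℤ ≤ apply φ (pt x)) B

  -- Any `suc n` large sublists of `C` share an element, so by Helly some `z` lies in the hulls of
  -- all of them. If the points with positive `ψ` formed a large sublist, `ψ` would be positive at
  -- `z` too.
  centrepoint : (C : List A) → 0 ℕ.< length C →
    Σ (Fin (suc n) → ℤ) λ z → 0ℤ < z zero × (∀ φ → NonnegOn C φ → 0ℤ ≤ apply φ z) ×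
      (∀ ψ → apply ψ z ≤ 0ℤ →
        suc (suc n) ℕ.* length (filter (λ x → 0ℤ ℤ.<? apply ψ (pt x)) C) ℕ.≤ suc n ℕ.* length C)
  centrepoint C 0<N = z , 0<z , (λ φ → inHull φ ⊆-refl C-large) , cut
    where
    Index = Σ (List A) (Large (suc n) C)
    -- The functionals nonnegative on `B` form its dual cone, so the cone with index `B` is the
    -- conical hull of the points of `B`.
    open Helly {I = Index} (λ B → NonnegOn (proj₁ B))

    C-large : suc n ℕ.* length C ℕ.< suc (suc n) ℕ.* length C
    C-large = ℕ.*-monoˡ-< (length C) {{ℕ.>-nonZero 0<N}} (ℕ.n<1+n (suc n))

    large? = λ (B : List A) → suc n ℕ.* length C ℕ.<? suc (suc n) ℕ.* length B
    larges : List (List A)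
    larges = filter large? (sublists C)

    few : ∀ {m} → m ℕ.≤ suc n → (F : Fin m → Index) → CommonPoint F
    few m≤ F =
      let x , x∈F = large-common 0<N m≤ (proj₁ ∘ F) (proj₂ ∘ F)
      in pt x , subst (0ℤ <_) (sym (pt-height x)) (+<+ ℕ.z<s) ,
         λ i φ nonneg → All.lookup nonneg (x∈F i)

    family : Fin (length larges) → Index
    family i =
      let B∈ , large = ∈-filter⁻ large? {xs = sublists C} (∈-lookup i)
      in lookup larges i , ∈-sublists⁻ C B∈ , large

    common : CommonPoint family
    common = helly few (length larges) family
    z   = proj₁ common
    0<z = proj₁ (proj₂ common)

    inHull : ∀ {B} φ → B ⊆ C → suc n ℕ.* length C ℕ.< suc (suc n) ℕ.* length B →
      NonnegOn B φ → 0ℤ ≤ apply φ z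
    inHull {B} φ B⊆C large nonneg =
      proj₂ (proj₂ common) (index B∈) φ (subst (λ D → NonnegOn D φ) (lookup-index B∈) nonneg)
      where
      B∈ : B ∈ larges
      B∈ = ∈-filter⁺ large? (∈-sublists⁺ B⊆C) large

    cut : ∀ ψ → apply ψ z ≤ 0ℤ →
      suc (suc n) ℕ.* length (filter (λ x → 0ℤ ℤ.<? apply ψ (pt x)) C) ℕ.≤ suc n ℕ.* length C
    cut ψ ψz≤0 = ℕ.≮⇒≥ λ large → ℤ.<-irrefl refl (ℤ.<-≤-trans 0<z (ℤ.≤-trans
      (height≤ (inHull ψ′ (filter-⊆ P? C) large (All.map (λ {x} → shifted x) (all-filter P? C))))
      ψz≤0))
      where
      P? = λ x → 0ℤ ℤ.<? apply ψ (pt x)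
      -- ψ takes integer values, so ψ > 0 on the points means that ψ - height ≥ 0 there.
      ψ′ = (zero , -1ℤ) ∷ ψ
      shifted : ∀ x → 0ℤ < apply ψ (pt x) → 0ℤ ≤ apply ψ′ (pt x)
      shifted x 0<ψ rewrite pt-height x = ℤ.+-monoʳ-≤ -1ℤ (ℤ.i<j⇒suc[i]≤j 0<ψ)
      height≤ : 0ℤ ≤ apply ψ′ z → z zero ≤ apply ψ z
      height≤ 0≤ = ℤ.0≤i-j⇒j≤i (subst (0ℤ ≤_) (trans (cong (_+ apply ψ z) (ℤ.-1*i≡-i (z zero)))
        (ℤ.+-comm (- z zero) (apply ψ z))) 0≤)

-- Edmonds' greedy vector and the Lovász extension.

module Greedy where
  open import Data.Integer using (_+_; _*_; _-_; _≤_; _<_; +≤+)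

  -- Homogeneous coordinates, so that the affine lower bounds on f become linear functionals.
  indicator : Subset n → Fin (suc n) → ℤ
  indicator Y zero    = 1ℤ
  indicator Y (suc i) = if lookupᵛ Y i then 1ℤ else 0ℤ

  steps : Subset n → List (Fin n) → List (Subset n)
  steps S []      = []
  steps S (i ∷ l) = S ∪ ⁅ i ⁆ ∷ steps (S ∪ ⁅ i ⁆) l

  endpoint : Subset n → List (Fin n) → Subset n
  endpoint S []      = S
  endpoint S (i ∷ l) = endpoint (S ∪ ⁅ i ⁆) l

  length-steps : ∀ (S : Subset n) l → length (steps S l) ≡ length l
  length-steps S []      = refl
  length-steps S (i ∷ l) = cong suc (length-steps (S ∪ ⁅ i ⁆) l)

  ⊆-endpoint : ∀ (S : Subset n) l → S ⊆ˢ endpoint S l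
  ⊆-endpoint S []      x∈S = x∈S
  ⊆-endpoint S (i ∷ l) x∈S = ⊆-endpoint (S ∪ ⁅ i ⁆) l (p⊆p∪q ⁅ i ⁆ x∈S)

  ∈-endpoint : ∀ (S : Subset n) {l i} → i ∈ l → i ∈ˢ endpoint S l
  ∈-endpoint S {i ∷ l} (here refl)  = ⊆-endpoint (S ∪ ⁅ i ⁆) l (q⊆p∪q S ⁅ i ⁆ (x∈⁅x⁆ i))
  ∈-endpoint S {j ∷ l} (there i∈l) = ∈-endpoint (S ∪ ⁅ j ⁆) i∈l

  endpoint-complete : ∀ (S : Subset n) {l} → (∀ i → i ∈ l) → endpoint S l ≡ ⊤
  endpoint-complete S complete = ⊆-antisym ⊆⊤ (λ {i} _ → ∈-endpoint S (complete i))

  -- The greedy vector with its sign reversed. It is built from the list of values along the chain,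
  -- which is all that the algorithm knows of `f`.
  losses : ℤ → List (Fin n) → List ℤ → Functional (suc n)
  losses v (i ∷ l) (u ∷ us) = (suc i , v - u) ∷ losses u l us
  losses v _       _        = []

  ∪-singleton-∈ : ∀ {S : Subset n} {i} → i ∈ˢ S → S ∪ ⁅ i ⁆ ≡ S
  ∪-singleton-∈ {S = S} {i} i∈S = ⊆-antisym (λ x∈ → absorb (x∈p∪q⁻ S ⁅ i ⁆ x∈)) (p⊆p∪q ⁅ i ⁆)
    where
    absorb : ∀ {x} → x ∈ˢ S ⊎ x ∈ˢ ⁅ i ⁆ → x ∈ˢ S
    absorb (inj₁ x∈S) = x∈S
    absorb (inj₂ x∈i) with refl ← x∈⁅y⁆⇒x≡y i x∈i = i∈S

  ∩-∪-singleton-∈ : ∀ (Y S : Subset n) {i} → i ∈ˢ Y → Y ∩ (S ∪ ⁅ i ⁆) ≡ (Y ∩ S) ∪ ⁅ i ⁆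
  ∩-∪-singleton-∈ Y S {i} i∈Y = trans (∩-distribˡ-∪ Y S ⁅ i ⁆) (cong ((Y ∩ S) ∪_)
    (⊆-antisym (p∩q⊆q Y ⁅ i ⁆) λ x∈i → x∈p∩q⁺ (subst (_∈ˢ Y) (sym (x∈⁅y⁆⇒x≡y i x∈i)) i∈Y , x∈i)))

  ∩-∪-singleton-∉ : ∀ (Y S : Subset n) {i} → i ∉ˢ Y → Y ∩ (S ∪ ⁅ i ⁆) ≡ Y ∩ S
  ∩-∪-singleton-∉ Y S {i} i∉Y = trans (∩-distribˡ-∪ Y S ⁅ i ⁆)
    (trans (cong ((Y ∩ S) ∪_) (⊆-antisym empty ⊥⊆)) (∪-identityʳ (Y ∩ S)))
    where
    empty : Y ∩ ⁅ i ⁆ ⊆ˢ ⊥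
    empty x∈ =
      let x∈Y , x∈i = x∈p∩q⁻ Y ⁅ i ⁆ x∈
      in contradiction (subst (_∈ˢ Y) (x∈⁅y⁆⇒x≡y i x∈i) x∈Y) i∉Y

  module _ {f : Subset n → ℤ} (submodular : Submodular f) where

    -- If `i` is in `Y` but not in `S`, this is submodularity for Y ∩ S inside `S`. Otherwise Y ∩ S
    -- does not change and the last product vanishes.
    restricted-step : ∀ Y S i →
      f (Y ∩ S) ≤ f (Y ∩ (S ∪ ⁅ i ⁆)) + (f S - f (S ∪ ⁅ i ⁆)) * indicator Y (suc i)
    restricted-step Y S i with i ∈? S
    ... | yes i∈S rewrite ∪-singleton-∈ i∈S =
      ℤ.≤-reflexive (cancel (f (Y ∩ S)) (f S) (indicator Y (suc i)))
      where
      cancel : ∀ x s c → x ≡ x + (s - s) * c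
      cancel = solve-∀
    ... | no i∉S with lookupᵛ Y i in eq
    ...   | true rewrite ∩-∪-singleton-∈ Y S (lookup⇒[]= i Y eq) = begin
      f (Y ∩ S) ≡⟨ regroup₁ (f (Y ∩ S)) (f S) (f (S ∪ ⁅ i ⁆)) ⟩
      (f (S ∪ ⁅ i ⁆) - f S) + (f (Y ∩ S) + (f S - f (S ∪ ⁅ i ⁆)))
        ≤⟨ ℤ.+-monoˡ-≤ _ (submodular (Y ∩ S) S i (p∩q⊆q Y S) i∉S) ⟩
      (f ((Y ∩ S) ∪ ⁅ i ⁆) - f (Y ∩ S)) + (f (Y ∩ S) + (f S - f (S ∪ ⁅ i ⁆)))
        ≡⟨ regroup₂ (f ((Y ∩ S) ∪ ⁅ i ⁆)) (f (Y ∩ S)) (f S - f (S ∪ ⁅ i ⁆)) ⟩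
      f ((Y ∩ S) ∪ ⁅ i ⁆) + (f S - f (S ∪ ⁅ i ⁆)) * 1ℤ ∎
      where
      open ℤ.≤-Reasoning
      regroup₁ : ∀ x s t → x ≡ (t - s) + (x + (s - t))
      regroup₁ = solve-∀
      regroup₂ : ∀ y x c → (y - x) + (x + c) ≡ y + c * 1ℤ
      regroup₂ = solve-∀
    ...   | false
      rewrite ∩-∪-singleton-∉ Y S (λ i∈Y → contradiction (trans (sym eq) ([]=⇒lookup i∈Y)) λ ()) =
      ℤ.≤-reflexive (cancel (f (Y ∩ S)) (f S - f (S ∪ ⁅ i ⁆)))
      where
      cancel : ∀ x c → x ≡ x + c * 0ℤ
      cancel = solve-∀

    restricted-chain : ∀ Y S l →
      f (Y ∩ S) ≤ f (Y ∩ endpoint S l) + apply (losses (f S) l (map f (steps S l))) (indicator Y)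
    restricted-chain Y S []      = ℤ.≤-reflexive (sym (ℤ.+-identityʳ _))
    restricted-chain Y S (i ∷ l) = begin
      f (Y ∩ S)                       ≤⟨ restricted-step Y S i ⟩
      f (Y ∩ S′) + c                  ≤⟨ ℤ.+-monoˡ-≤ c (restricted-chain Y S′ l) ⟩
      (f (Y ∩ endpoint S′ l) + r) + c ≡⟨ regroup (f (Y ∩ endpoint S′ l)) r c ⟩
      f (Y ∩ endpoint S′ l) + (c + r) ∎
      where
      open ℤ.≤-Reasoning
      S′ = S ∪ ⁅ i ⁆
      c = (f S - f S′) * indicator Y (suc i)
      r = apply (losses (f S′) l (map f (steps S′ l))) (indicator Y)
      regroup : ∀ x r c → (x + r) + c ≡ x + (c + r)
      regroup = solve-∀

    -- As the chain runs from `⊥` to `⊤`, its intersection with `Y` runs from `⊥` to `Y`, and the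
    -- steps telescope. The loss is kept on the right: f Y is at least f ⊥ plus the greedy vector
    -- summed over `Y`.
    greedy-lower-bound : ∀ Y {l} → (∀ i → i ∈ l) →
      f ⊥ ≤ f Y + apply (losses (f ⊥) l (map f (steps ⊥ l))) (indicator Y)
    greedy-lower-bound Y {l} complete =
      subst₂ (λ S T → f S ≤ f T + apply (losses (f ⊥) l (map f (steps ⊥ l))) (indicator Y))
        (∩-zeroʳ Y) (trans (cong (Y ∩_) (endpoint-complete ⊥ complete)) (∩-identityʳ Y))
        (restricted-chain Y ⊥ l)

  -- Abel summation: the value of the Lovász extension at z is a nonnegative
  -- combination, of total weight w, of the values of f along the chain.
  lovász-lower-bound : ∀ (f : Subset n → ℤ) (z : Fin (suc n) → ℤ) {v} →
    (∀ i → 0ℤ ≤ z (suc i)) →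
    ∀ w S l → 0ℤ ≤ w → All (λ i → z (suc i) ≤ w) l → AllPairs (λ i j → z (suc j) ≤ z (suc i)) l →
    v ≤ f S → All (λ T → v ≤ f T) (steps S l) →
    v * w + apply (losses (f S) l (map f (steps S l))) z ≤ f S * w
  lovász-lower-bound f z {v} 0≤z w S [] 0≤w _ _ v≤fS _ =
    subst (_≤ f S * w) (sym (ℤ.+-identityʳ (v * w)))
      (ℤ.*-monoʳ-≤-nonNeg w {{ℤ.nonNegative 0≤w}} v≤fS)
  lovász-lower-bound f z {v} 0≤z w S (i ∷ l) 0≤w (x≤w ∷ _) (l≤x ∷ sorted)
                     v≤fS (v≤fS′ ∷ v≤steps) = begin
    v * w + ((f S - f S′) * x + r) ≡⟨ regroup₁ v w x (f S) (f S′) r ⟩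
    v * (w - x) + (v * x + r) + (f S - f S′) * x
      ≤⟨ ℤ.+-monoˡ-≤ ((f S - f S′) * x) (ℤ.+-mono-≤
           (ℤ.*-monoʳ-≤-nonNeg (w - x) {{ℤ.nonNegative (ℤ.i≤j⇒0≤j-i x≤w)}} v≤fS)
           (lovász-lower-bound f z 0≤z x S′ l (0≤z i) l≤x sorted v≤fS′ v≤steps)) ⟩
    f S * (w - x) + f S′ * x + (f S - f S′) * x ≡⟨ regroup₂ (f S) (f S′) w x ⟩
    f S * w ∎
    where
    open ℤ.≤-Reasoning
    S′ = S ∪ ⁅ i ⁆
    x = z (suc i)
    r = apply (losses (f S′) l (map f (steps S′ l))) z
    regroup₁ : ∀ v w x s t r → v * w + ((s - t) * x + r) ≡ v * (w - x) + (v * x + r) + (s - t) * x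
    regroup₁ = solve-∀
    regroup₂ : ∀ s t w x → s * (w - x) + t * x + (s - t) * x ≡ s * w
    regroup₂ = solve-∀

  chain : List (Fin n) → List (Subset n)
  chain l = ⊥ ∷ steps ⊥ l

  -- Positive at Y iff the greedy lower bound for f Y, with us the values of f on chain l, is below v.
  improvement : ℤ → List (Fin n) → List ℤ → Functional (suc n)
  improvement v l []       = []
  improvement v l (u ∷ us) = (zero , v - u) ∷ losses u l us

  improving : ℤ → List (Fin n) → List ℤ → List (Subset n) → List (Subset n)
  improving v l us = filter (λ Y → 0ℤ ℤ.<? apply (improvement v l us) (indicator Y))

  descending : (Fin n → ℤ) → DecTotalOrder _ _ _
  descending x = Flip.decTotalOrder (On.decTotalOrder ℤ.≤-decTotalOrder x)

  -- The order depends on `C` alone and can be fixed before the chain is queried; hence `cuts`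
  -- ranges over every `f`.
  record CuttingOrder (C : List (Subset n)) : Set where
    field
      order        : List (Fin n)
      length-order : length order ≡ n
      complete     : ∀ i → i ∈ order
      cuts         : ∀ (f : Subset n → ℤ) {v} → All (λ S → v ≤ f S) (chain order) →
        suc (suc n) ℕ.* length (improving v order (map f (chain order)) C) ℕ.≤ suc n ℕ.* length C

  open CuttingOrder public

  cuttingOrder : (C : List (Subset n)) → CuttingOrder C
  -- Without candidates there is no centrepoint; any order serves, as both sides of `cuts` are zero.
  cuttingOrder {n} [] = record
    { order        = allFin n
    ; length-order = length-tabulate {n = n} _
    ; complete     = ∈-allFin
    ; cuts         = λ f _ → ℕ.≤-reflexive (trans (ℕ.*-zeroʳ (suc (suc n))) (sym (ℕ.*-zeroʳ (suc n))))
    }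
  cuttingOrder {n} C@(_ ∷ _) with Centrepoint.centrepoint {n} indicator (λ _ → refl) C ℕ.z<s
  ... | z , 0<w , inHull , cut = record
    { order        = l
    ; length-order = trans (↭-length (sort-↭ (allFin n))) (length-tabulate {n = n} _)
    ; complete     = λ i → ∈-resp-↭ (↭-sym (sort-↭ (allFin n))) (∈-allFin i)
    ; cuts         = λ f {v} v≤ → cut (improvement v l (map f (chain l))) (nonpositive f v≤)
    }
    where
    open Sort (descending (z ∘ suc)) using (sort; sort-↭; sort-↗)
    l = sort (allFin n)

    indicator-nonneg : ∀ Y i → 0ℤ ≤ indicator {n} Y (suc i)
    indicator-nonneg Y i with lookupᵛ Y i
    ... | true  = +≤+ ℕ.z≤n
    ... | false = +≤+ ℕ.z≤n

    indicator-≤1 : ∀ Y i → indicator {n} Y (suc i) ≤ 1ℤ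
    indicator-≤1 Y i with lookupᵛ Y i
    ... | true  = ℤ.≤-refl
    ... | false = +≤+ ℕ.z≤n

    single : ∀ x → 1ℤ * x + 0ℤ ≡ x
    single = solve-∀
    difference : ∀ w x → 1ℤ * w + (-1ℤ * x + 0ℤ) ≡ w - x
    difference = solve-∀

    -- This bound and the next pass from the indicator vectors to `z`, which lies in their hull;
    -- Abel summation along the sorted chain relies on both.
    0≤z : ∀ i → 0ℤ ≤ z (suc i)
    0≤z i = subst (0ℤ ≤_) (single (z (suc i))) (inHull ((suc i , 1ℤ) ∷ [])
      (All.universal (λ Y →
        subst (0ℤ ≤_) (sym (single (indicator Y (suc i)))) (indicator-nonneg Y i)) C))

    z≤w : ∀ i → z (suc i) ≤ z zero
    z≤w i = ℤ.0≤i-j⇒j≤i (subst (0ℤ ≤_) (difference (z zero) (z (suc i)))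
      (inHull ((zero , 1ℤ) ∷ (suc i , -1ℤ) ∷ []) (All.universal (λ Y →
        subst (0ℤ ≤_) (sym (difference 1ℤ (indicator Y (suc i))))
          (ℤ.i≤j⇒0≤j-i (indicator-≤1 Y i))) C)))

    sorted : AllPairs (λ i j → z (suc j) ≤ z (suc i)) l
    sorted = Sorted⇒AllPairs (DecTotalOrder.totalOrder (descending (z ∘ suc))) (sort-↗ (allFin n))

    nonpositive : ∀ f {v} → All (λ S → v ≤ f S) (chain l) →
      apply (improvement v l (map f (chain l))) z ≤ 0ℤ
    nonpositive f {v} (v≤f⊥ ∷ v≤steps) = begin
      (v - f ⊥) * w + r       ≡⟨ regroup v (f ⊥) w r ⟩
      (v * w + r) - f ⊥ * w   ≤⟨ ℤ.i≤j⇒i-j≤0 (lovász-lower-bound f z 0≤z w ⊥ l (ℤ.<⇒≤ 0<w)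
                                   (All.universal z≤w l) sorted v≤f⊥ v≤steps) ⟩
      0ℤ                      ∎
      where
      open ℤ.≤-Reasoning
      w = z zero
      r = apply (losses (f ⊥) l (map f (steps ⊥ l))) z
      regroup : ∀ v u w r → (v - u) * w + r ≡ (v * w + r) - u * w
      regroup = solve-∀

open Greedy

-- The algorithm, its correctness and its number of queries.

module Search where
  open import Data.Integer using (_≤_; _<_; _-_; _+_; _*_)

  queryAll : List (Subset n) → (List ℤ → OracleAlg n) → OracleAlg n
  queryAll []       k = k []
  queryAll (S ∷ Ss) k = query S (λ v → queryAll Ss (λ vs → k (v ∷ vs)))

  run-queryAll : ∀ Ss k (f : Subset n → ℤ) → run (queryAll Ss k) f ≡ run (k (map f Ss)) f
  run-queryAll []       k f = refl
  run-queryAll (S ∷ Ss) k f = run-queryAll Ss (λ vs → k (f S ∷ vs)) f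

  calls-queryAll : ∀ Ss k (f : Subset n → ℤ) →
    calls (queryAll Ss k) f ≡ length Ss ℕ.+ calls (k (map f Ss)) f
  calls-queryAll []       k f = refl
  calls-queryAll (S ∷ Ss) k f = cong suc (calls-queryAll Ss (λ vs → k (f S ∷ vs)) f)

  -- The incumbent is stored with its value, so that later comparisons cost no oracle call.
  record State (n : ℕ) : Set where
    constructor state
    field
      candidates : List (Subset n)
      incumbent  : Subset n × ℤ

  open State

  nextQueries : State n → List (Subset n)
  nextQueries st = chain (order (cuttingOrder (candidates st)))

  refine : State n → List ℤ → State n
  refine st vs =
    state (improving (proj₂ best) (order (cuttingOrder (candidates st))) vs (candidates st)) best
    -- The incumbent is updated before the cut, so its value is at most all values on the chain, as
    -- `cuts` requires.
    where best = argmin proj₂ (incumbent st) (zip (nextQueries st) vs)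

  search : ℕ → State n → OracleAlg n
  search zero    st = output (proj₁ (incumbent st))
  search (suc k) st = queryAll (nextQueries st) (λ vs → search k (refine st vs))

  -- An equality, since `search` always performs all `k` rounds, each querying the `suc n` sets of a
  -- maximal chain.
  calls-search : ∀ k (st : State n) f → calls (search k st) f ≡ k ℕ.* suc n
  calls-search zero    st f = refl
  calls-search (suc k) st f = trans (calls-queryAll (nextQueries st) (λ vs → search k (refine st vs)) f)
    (cong₂ ℕ._+_ (cong suc (trans (length-steps ⊥ (order co)) (length-order co)))
      (calls-search k (refine st (map f (nextQueries st))) f))
    where co = cuttingOrder (candidates st)

  zip-map : {B : Set} (f : A → B) (xs : List A) → zip xs (map f xs) ≡ map (λ x → x , f x) xs
  zip-map f []       = refl
  zip-map f (x ∷ xs) = cong ((x , f x) ∷_) (zip-map f xs)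

  module _ {f : Subset n → ℤ} (submodular : Submodular f) where

    -- The loop invariant: only sets that cannot beat the incumbent have been dropped. With no
    -- candidates left, the incumbent is a minimizer.
    record Valid (st : State n) : Set where
      field
        incumbent-value : f (proj₁ (incumbent st)) ≡ proj₂ (incumbent st)
        covers : ∀ Y → proj₂ (incumbent st) ≤ f Y ⊎ Y ∈ candidates st

    open Valid

    module Round (st : State n) where
      co  = cuttingOrder (candidates st)
      l   = order co
      us  = map f (chain l)
      st′ = refine st us
      v′  = proj₂ (incumbent st′)

      best≤chain : All (λ S → v′ ≤ f S) (chain l)
      best≤chain = All-map⁻ {f = λ S → S , f S} (subst (All (λ p → v′ ≤ proj₂ p))
        (zip-map f (chain l)) (f[argmin]≤f[xs] {f = proj₂} (incumbent st) (zip (chain l) us)))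

      best≤old : v′ ≤ proj₂ (incumbent st)
      best≤old = f[argmin]≤f[⊤] {f = proj₂} (incumbent st) (zip (chain l) us)

      shrinks : suc (suc n) ℕ.* length (candidates st′) ℕ.≤ suc n ℕ.* length (candidates st)
      shrinks = cuts co f best≤chain

      φ = improvement v′ l us

      -- The greedy bound at `Y` is `f ⊥ - r`, and `φ` there is `v′` minus this bound; if that is
      -- not positive, `v′` is at most the bound and so at most `f Y`.
      discarded : ∀ Y → ¬ 0ℤ < apply φ (indicator Y) → v′ ≤ f Y
      discarded Y ¬0< = begin
        v′                                ≡⟨ regroup₁ v′ (f ⊥) r ⟩
        ((v′ - f ⊥) * 1ℤ + r) + (f ⊥ - r) ≤⟨ ℤ.+-mono-≤ (ℤ.≮⇒≥ ¬0<) (ℤ.+-monoˡ-≤ (ℤ.- r)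
                                               (greedy-lower-bound {f = f} submodular Y (complete co))) ⟩
        0ℤ + ((f Y + r) - r)              ≡⟨ regroup₂ (f Y) r ⟩
        f Y                               ∎
        where
        open ℤ.≤-Reasoning
        r = apply (losses (f ⊥) l (map f (steps ⊥ l))) (indicator Y)
        regroup₁ : ∀ v u r → v ≡ ((v - u) * 1ℤ + r) + (u - r)
        regroup₁ = solve-∀
        regroup₂ : ∀ y r → 0ℤ + ((y + r) - r) ≡ y
        regroup₂ = solve-∀

      valid′ : Valid st → Valid st′
      valid′ valid .incumbent-value =
        argmin-all proj₂ {P = λ p → f (proj₁ p) ≡ proj₂ p} (incumbent-value valid)
          (subst (All _) (sym (zip-map f (chain l)))
            (All-map⁺ (All.universal (λ _ → refl) (chain l))))
      valid′ valid .covers Y with covers valid Y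
      ... | inj₁ v≤fY = inj₁ (ℤ.≤-trans best≤old v≤fY)
      ... | inj₂ Y∈C with 0ℤ ℤ.<? apply φ (indicator Y)
      ...   | yes 0<ψ = inj₂ (∈-filter⁺ (λ Y → 0ℤ ℤ.<? apply φ (indicator Y)) Y∈C 0<ψ)
      ...   | no ¬0<ψ = inj₁ (discarded Y ¬0<ψ)

    -- Each round multiplies the number of candidates by at most (n+1)/(n+2), which preserves the
    -- numerical hypothesis with one round fewer. At `k = 0` it says that fewer than one candidate
    -- remains.
    search-correct : ∀ k st → Valid st →
      length (candidates st) ℕ.* suc n ℕ.^ k ℕ.< suc (suc n) ℕ.^ k →
      IsMinimizer f (run (search k st) f)
    search-correct zero st valid small Y with covers valid Y
    ... | inj₁ v≤fY = subst (_≤ f Y) (sym (incumbent-value valid)) v≤fY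
    search-correct zero (state [] _)      valid small        Y | inj₂ ()
    search-correct zero (state (_ ∷ _) _) valid (ℕ.s≤s ()) Y | inj₂ _
    search-correct (suc k) st valid small =
      subst (IsMinimizer f) (sym (run-queryAll (nextQueries st) (λ vs → search k (refine st vs)) f))
        (search-correct k st′ (valid′ valid) (ℕ.*-cancelˡ-< (suc (suc n)) (N′ ℕ.* p) (suc (suc n) ℕ.^ k)
          (begin-strict
            suc (suc n) ℕ.* (N′ ℕ.* p)        ≡⟨ ℕ.*-assoc (suc (suc n)) N′ p ⟨
            suc (suc n) ℕ.* N′ ℕ.* p          ≤⟨ ℕ.*-monoˡ-≤ p shrinks ⟩
            suc n ℕ.* N ℕ.* p                 ≡⟨ regroup (suc n) N p ⟩
            N ℕ.* (suc n ℕ.* p)               <⟨ small ⟩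
            suc (suc n) ℕ.* suc (suc n) ℕ.^ k ∎)))
      where
      open Round st
      open ℕ.≤-Reasoning
      N  = length (candidates st)
      N′ = length (candidates st′)
      p  = suc n ℕ.^ k
      regroup : ∀ d c p → d ℕ.* c ℕ.* p ≡ c ℕ.* (d ℕ.* p)
      regroup = solveℕ-∀

open Search

-- Counting candidates, rounds and queries.

subsets : ∀ n → List (Subset n)
subsets zero    = [] ∷ []
subsets (suc n) = map (inside ∷_) (subsets n) ++ map (outside ∷_) (subsets n)

∈-subsets : ∀ (S : Subset n) → S ∈ subsets n
∈-subsets []         = here refl
∈-subsets (true ∷ S) = ∈-++⁺ˡ (∈-map⁺ (inside ∷_) (∈-subsets S))
∈-subsets {suc n} (false ∷ S) =
  ∈-++⁺ʳ (map (inside ∷_) (subsets n)) (∈-map⁺ (outside ∷_) (∈-subsets S))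

open import Data.Nat using (_+_; _*_; _^_; _≤_; _<_)

length-subsets : ∀ n → length (subsets n) ≡ 2 ^ n
length-subsets zero    = refl
length-subsets (suc n) = trans (length-++ (map (inside ∷_) (subsets n)))
  (cong₂ _+_ (trans (length-map (inside ∷_) (subsets n)) (length-subsets n))
    (trans (length-map (outside ∷_) (subsets n))
      (trans (length-subsets n) (sym (ℕ.+-identityʳ (2 ^ n))))))

-- Bernoulli's inequality (1 + 1/d)^k ≥ 1 + k/d with denominators cleared.
bernoulli : ∀ d k → d ^ k * (d + k) ≤ d * suc d ^ k
bernoulli d zero    = ℕ.≤-reflexive (regroup d)
  where
  regroup : ∀ d → 1 * (d + 0) ≡ d * 1
  regroup = solveℕ-∀
bernoulli d (suc k) = begin
  d * d ^ k * (d + suc k)                 ≤⟨ ℕ.m≤m+n _ (d ^ k * k) ⟩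
  d * d ^ k * (d + suc k) + d ^ k * k     ≡⟨ regroup₁ d (d ^ k) k ⟩
  suc d * (d ^ k * (d + k))               ≤⟨ ℕ.*-monoʳ-≤ (suc d) (bernoulli d k) ⟩
  suc d * (d * suc d ^ k)                 ≡⟨ regroup₂ d (suc d ^ k) ⟩
  d * (suc d * suc d ^ k)                 ∎
  where
  open ℕ.≤-Reasoning
  regroup₁ : ∀ d p k → d * p * (d + suc k) + p * k ≡ suc d * (p * (d + k))
  regroup₁ = solveℕ-∀
  regroup₂ : ∀ d q → suc d * (d * q) ≡ d * (suc d * q)
  regroup₂ = solveℕ-∀

halving : ∀ n → 2 * suc n ^ suc n ≤ suc (suc n) ^ suc n
halving n = ℕ.*-cancelˡ-≤ (suc n)
  (ℕ.≤-trans (ℕ.≤-reflexive (regroup (suc n) (suc n ^ suc n))) (bernoulli (suc n) (suc n)))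
  where
  regroup : ∀ d p → d * (2 * p) ≡ p * (d + d)
  regroup = solveℕ-∀

-- By `halving`, `suc n` rounds at least halve the candidates; `suc n` such blocks bring 2^n below
-- one.
enough-rounds : ∀ n → 2 ^ n * suc n ^ (suc n * suc n) < suc (suc n) ^ (suc n * suc n)
enough-rounds n = begin-strict
  2 ^ n * d ^ (d * d)      <⟨ ℕ.*-monoˡ-< (d ^ (d * d)) {{ℕ.m^n≢0 d (d * d)}}
                                (ℕ.^-monoʳ-< 2 (ℕ.s<s ℕ.z<s) (ℕ.n<1+n n)) ⟩
  2 ^ d * d ^ (d * d)      ≡⟨ cong (2 ^ d *_) (ℕ.^-*-assoc d d d) ⟨
  2 ^ d * (d ^ d) ^ d      ≡⟨ ^-distribʳ-* 2 (d ^ d) d ⟨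
  (2 * d ^ d) ^ d          ≤⟨ ℕ.^-monoˡ-≤ d (halving n) ⟩
  (suc d ^ d) ^ d          ≡⟨ ℕ.^-*-assoc (suc d) d d ⟩
  suc d ^ (d * d)          ∎
  where
  open ℕ.≤-Reasoning
  d = suc n
  ^-distribʳ-* : ∀ a b k → (a * b) ^ k ≡ a ^ k * b ^ k
  ^-distribʳ-* a b zero    = refl
  ^-distribʳ-* a b (suc k) = trans (cong (a * b *_) (^-distribʳ-* a b k)) (regroup a b (a ^ k) (b ^ k))
    where
    regroup : ∀ a b x y → a * b * (x * y) ≡ a * x * (b * y)
    regroup = solveℕ-∀

-- The constant is 9 = 1 + 2^3, from 1 ≤ n^3 and n + 1 ≤ 2n; the threshold 2 makes the logarithm at
-- least 1.
query-bound : ∀ n → 2 ≤ n → suc (suc n * suc n * suc n) ≤ 9 * (n ^ 3 * ⌊log₂ n ⌋)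
query-bound n 2≤n = begin
  1 + suc n * suc n * suc n           ≤⟨ ℕ.+-mono-≤ (ℕ.m^n>0 n {{nonZero}} 3)
                                           (ℕ.*-mono-≤ (ℕ.*-mono-≤ n+1≤2n n+1≤2n) n+1≤2n) ⟩
  n ^ 3 + (n + n) * (n + n) * (n + n) ≡⟨ regroup n ⟩
  9 * (n ^ 3 * 1)                     ≤⟨ ℕ.*-monoʳ-≤ 9 (ℕ.*-monoʳ-≤ (n ^ 3) (⌊log₂⌋-mono-≤ 2≤n)) ⟩
  9 * (n ^ 3 * ⌊log₂ n ⌋)             ∎
  where
  open ℕ.≤-Reasoning
  nonZero = ℕ.>-nonZero (ℕ.≤-trans (ℕ.s≤s ℕ.z≤n) 2≤n)
  n+1≤2n : suc n ≤ n + n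
  n+1≤2n = ℕ.+-monoˡ-≤ n (ℕ.≤-trans (ℕ.s≤s ℕ.z≤n) 2≤n)
  regroup : ∀ n → n * (n * (n * 1)) + (n + n) * (n + n) * (n + n) ≡ 9 * (n * (n * (n * 1)) * 1)
  regroup = solveℕ-∀

initialState : ∀ n → ℤ → State n
initialState n v = state (subsets n) (⊥ , v)

minimize : ∀ n → OracleAlg n
-- The extra query supplies a first incumbent and accounts for the outer `suc` in `query-bound`.
minimize n = query ⊥ (λ v → search (suc n * suc n) (initialState n v))

mainTheorem12 : ∃[ c ] ∃[ n₀ ] Σ ((n : ℕ) → OracleAlg n) (λ A →
    (n : ℕ) (f : Subset n → ℤ) → Submodular f →
    IsMinimizer f (run (A n) f) × (n₀ ≤ n → calls (A n) f ≤ c * (n ^ 3 * ⌊log₂ n ⌋)))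
mainTheorem12 = 9 , 2 , minimize , λ n f submodular →
  search-correct submodular (suc n * suc n) (initialState n (f ⊥))
    (record { incumbent-value = refl ; covers = λ Y → inj₂ (∈-subsets Y) })
    (subst (λ N → N * suc n ^ (suc n * suc n) < suc (suc n) ^ (suc n * suc n))
      (sym (length-subsets n)) (enough-rounds n)) ,
  λ 2≤n → subst (_≤ 9 * (n ^ 3 * ⌊log₂ n ⌋))
    (cong suc (sym (calls-search (suc n * suc n) (initialState n (f ⊥)) f))) (query-bound n 2≤n)
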